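{- Let $n\ge 1$ be an integer and $A,B\in\mathbb{N}$. Put $\bar A=A\bmod n$, $\bar B=B\bmod n$, $m=n^3\mathbin{\dot{ - }}\bar B$, \[ w=n+12,\qquad T=n^2+n+1,\qquad q=2^{2w}, \] and for $i,j,k\ge 0$ write \[ S(i,j,k)=G_i(q,\,n-1)\;G_j(q^{\,n},\,n-1)\;G_k(q^{\,n^2},\,T-1). \] Define the two natural numbers \begin{align*} S_E^+ ={}& S(0,4,0)+m^2S(0,0,0)+S(6,0,0)+\bar A^2S(2,0,0)+n^2S(0,0,2)\\ &+2m\,S(0,2,0)+2\bar A\,S(4,0,0)+2n\,S(3,0,1)+2\bar A n\,S(1,0,1),\\ S_E^- ={}& 2\,S(3,2,0)+2\bar A\,S(1,2,0)+2n\,S(0,2,1)\\ &+2m\,S(3,0,0)+2\bar A m\,S(1,0,0)+2mn\,S(0,0,1), \end{align*} and \[ M=\bigl(2^w\mathbin{\dot{ - }}1\bigr)\Bigl(\bigl(2^w+1\bigr)S(0,0,0)+S_E^-\;\mathbin{\dot{ - }}\;S_E^+\Bigr). \] Then the number $N$ of points $(x,y)\in(\mathbb{Z}/n\mathbb{Z})^2$ with $y^2=x^3+Ax+B$ equals \[ N=\frac{\operatorname{HW}(M)}{w}\;\mathbin{\dot{ - }}\;n^2T . \]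
   Context: $\mathbb{N}$ is the set of natural numbers including $0$. Truncated subtraction is $x\mathbin{\dot{ - }}y=\max(x-y,0)$; in the definition of $M$ the truncated subtraction inside the large parentheses is applied to the whole sum $(2^w+1)S(0,0,0)+S_E^-$ and $S_E^+$. $a\bmod n$ is the least nonnegative residue. $\operatorname{HW}(M)$ is the number of ones in the binary representation of $M$. The generalized geometric progression is $G_r(q,t)=\sum_{j=0}^{t}j^r q^j$ for $q>1$, $t\ge 0$, $r\ge 0$, with the convention $0^0=1$. -}

module Defs where

open import Data.Digit using (toDigits; 1b)
open import Data.Fin.Base using (Fin; toℕ)
open import Data.Fin.Properties using (_≟_)
open import Data.List.Base
  using (map; upTo; allFin; cartesianProduct; filter; length)
open import Data.Nat.Base
  using (ℕ; suc; _+_; _*_; _∸_; _^_; NonZero; >-nonZero; z<s)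
open import Data.Nat.DivMod using (_%_; _mod_)
open import Data.Nat.ListAction using (sum)
open import Data.Nat.Properties using (<-≤-trans; m≤n+m)
open import Data.Product.Base using (_×_; _,_; proj₁)
open import Relation.Binary.PropositionalEquality.Core using (_≡_)
open import Relation.Unary using (Decidable)

-- Number of ones in the binary representation.
HW : ℕ → ℕ
HW M = length (filter (_≟ 1b) (proj₁ (toDigits 2 M)))

-- G r q t = Σ_{j=0}^{t} j^r q^j; the library's _^_ satisfies 0 ^ 0 ≡ 1.
G : (r q t : ℕ) → ℕ
G r q t = sum (map (λ j → j ^ r * q ^ j) (upTo (suc t)))

-- The ring ℤ/nℤ, carried by the least nonnegative residues.
module IntegersMod (n : ℕ) .{{_ : NonZero n}} where

  infixl 6 _⊕_
  infixl 7 _⊗_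

  ℤ/n : Set
  ℤ/n = Fin n

  ⟦_⟧ : ℕ → ℤ/n
  ⟦ a ⟧ = a mod n

  _⊕_ _⊗_ : ℤ/n → ℤ/n → ℤ/n
  x ⊕ y = ⟦ toℕ x + toℕ y ⟧
  x ⊗ y = ⟦ toℕ x * toℕ y ⟧

module Curve (n A B : ℕ) .{{_ : NonZero n}} where

  open IntegersMod n

  OnCurve : ℤ/n × ℤ/n → Set
  OnCurve (x , y) = y ⊗ y ≡ x ⊗ x ⊗ x ⊕ ⟦ A ⟧ ⊗ x ⊕ ⟦ B ⟧

  onCurve? : Decidable OnCurve
  onCurve? (x , y) = y ⊗ y ≟ x ⊗ x ⊗ x ⊕ ⟦ A ⟧ ⊗ x ⊕ ⟦ B ⟧

  N : ℕ
  N = length (filter onCurve? (cartesianProduct (allFin n) (allFin n)))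

  Ā B̄ m w T q : ℕ
  Ā = A % n
  B̄ = B % n
  m = n ^ 3 ∸ B̄
  w = n + 12
  T = n ^ 2 + n + 1
  q = 2 ^ (2 * w)

  instance
    w-nonZero : NonZero w
    w-nonZero = >-nonZero (<-≤-trans z<s (m≤n+m 12 n))

  S : (i j k : ℕ) → ℕ
  S i j k = G i q (n ∸ 1) * G j (q ^ n) (n ∸ 1) * G k (q ^ (n ^ 2)) (T ∸ 1)

  S⁺ S⁻ M : ℕ
  S⁺ = S 0 4 0 + m ^ 2 * S 0 0 0 + S 6 0 0 + Ā ^ 2 * S 2 0 0 + n ^ 2 * S 0 0 2
     + 2 * m * S 0 2 0 + 2 * Ā * S 4 0 0 + 2 * n * S 3 0 1 + 2 * Ā * n * S 1 0 1
  S⁻ = 2 * S 3 2 0 + 2 * Ā * S 1 2 0 + 2 * n * S 0 2 1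
     + 2 * m * S 3 0 0 + 2 * Ā * m * S 1 0 0 + 2 * m * n * S 0 0 1
  M  = (2 ^ w ∸ 1) * (((2 ^ w + 1) * S 0 0 0 + S⁻) ∸ S⁺)

{-# OPTIONS --safe #-}

-- Put E(x,y,z) = (y² + m − x³ − Āx − nz)². For residues x, y < n the number y² + m − x³ − Āx lies in
-- [0, nT) and is congruent to y² − x³ − Ax − B, so E(x,y,z) = 0 for exactly one z < T if (x,y) is on
-- the curve, and for none otherwise. Expanding the square, the second factor of M is
-- Σ (2ʷ + 1 − E(x,y,z)) q^(x + ny + n²z), whence M = Σ (2ʷ − 1)(2ʷ + 1 − E(x,y,z)) q^(x + ny + n²z).
-- As 0 ≤ E ≤ 2ʷ, each coefficient is a base-q digit; it has 2w binary ones if E = 0 and w otherwise.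

module Submission where

open import Defs
open import Data.Bool.Base using (if_then_else_)
open import Data.Digit using (Bit; Expansion; fromDigits; toDigits; 1b)
open import Data.Fin.Base using (Fin; zero; suc; toℕ; fromℕ<)
import Data.Fin.Properties as Fin
open import Data.Fin.Properties using (toℕ<n; toℕ-fromℕ<; toℕ-injective; _≟_)
open import Data.List.Base
  using ([]; _∷_; _++_; map; applyUpTo; tabulate; cartesianProduct; filter; length)
open import Data.List.Properties using (map-tabulate; length-++; filter-++; map-applyUpTo)
open import Data.Nat.Base
  using (ℕ; zero; suc; _+_; _*_; _∸_; _^_; _/_; _%_; _≤_; _<_; z≤n; s≤s; z<s; NonZero
        ; ∣_-_∣; _≤′_; ≤′-refl; ≤′-step)
open import Data.Nat.Divisibility using (_∣_; divides)
open import Data.Nat.DivMod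
open import Data.Nat.ListAction as List using ()
open import Data.Nat.Properties as ℕ hiding (_≟_)
open import Data.Nat.Solver using (module +-*-Solver)
open import Data.Product.Base using (_×_; _,_; proj₁; proj₂; ∃)
open import Data.Sum.Base using (inj₁; inj₂)
open import Function.Base using (_∘_; id)
open import Relation.Binary.PropositionalEquality
open import Relation.Nullary using (Dec; yes; no; does; ¬_; contradiction)
open import Relation.Unary using (Decidable)
open +-*-Solver using (solve; _:=_; _:+_; _:*_; _:^_; con)
open import Algebra.Properties.Semiring.Sum +-*-semiring

-- Binary weight

ones : Expansion 2 → ℕ
ones ds = length (filter (_≟ 1b) ds)

-- `toDigits` is used only through the value of its expansion. Expansions are little-endian, and two
-- of equal value differ only by zeros at the end of the list; parity forces the heads to agree.
-- Hence any expansion may serve to compute `HW`.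
ones-cong : ∀ ds es → fromDigits ds ≡ fromDigits es → ones ds ≡ ones es
ones-cong []              []              eq = refl
ones-cong []              (zero ∷ es)     eq = ones-cong [] es (*-cancelʳ-≡ 0 (fromDigits es) 2 eq)
ones-cong (zero ∷ ds)     []              eq = ones-cong ds [] (*-cancelʳ-≡ (fromDigits ds) 0 2 eq)
ones-cong (zero ∷ ds)     (zero ∷ es)     eq =
  ones-cong ds es (*-cancelʳ-≡ (fromDigits ds) (fromDigits es) 2 eq)
ones-cong (zero ∷ ds)     (suc zero ∷ es) eq = contradiction
  (trans (*-comm 2 (fromDigits ds)) (trans eq (cong suc (*-comm (fromDigits es) 2))))
  (even≢odd (fromDigits ds) (fromDigits es))
ones-cong (suc zero ∷ ds) (zero ∷ es)     eq = contradiction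
  (trans (*-comm 2 (fromDigits es)) (trans (sym eq) (cong suc (*-comm (fromDigits ds) 2))))
  (even≢odd (fromDigits es) (fromDigits ds))
ones-cong (suc zero ∷ ds) (suc zero ∷ es) eq = cong suc
  (ones-cong ds es (*-cancelʳ-≡ (fromDigits ds) (fromDigits es) 2 (suc-injective eq)))

ones-∷ : ∀ d ds → ones (d ∷ ds) ≡ toℕ d + ones ds
ones-∷ zero       ds = refl
ones-∷ (suc zero) ds = refl

HW-digit : ∀ (d : Bit) m → HW (toℕ d + m * 2) ≡ toℕ d + HW m
HW-digit d m = trans
  (ones-cong (proj₁ (toDigits 2 (toℕ d + m * 2))) (d ∷ proj₁ (toDigits 2 m))
    (trans (proj₂ (toDigits 2 (toℕ d + m * 2)))
           (cong (λ k → toℕ d + k * 2) (sym (proj₂ (toDigits 2 m))))))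
  (ones-∷ d (proj₁ (toDigits 2 m)))

-- A view exposing the lowest bit: matching on it replaces the number by `toℕ d + m * 2`, the form
-- in which `HW-digit` applies.
data Binary : ℕ → Set where
  _+[_]*2 : (d : Bit) (m : ℕ) → Binary (toℕ d + m * 2)

binary : ∀ m → Binary m
binary m with m divMod 2
... | result q d refl = d +[ q ]*2

-- Because `a` fits into `k` bits, the bits of `b` sit above it without a carry. The induction
-- strips one low bit of `a` per step.
HW-concat : ∀ k {a} b → a < 2 ^ k → HW (a + b * 2 ^ k) ≡ HW a + HW b
HW-concat zero    {zero}  b a< = cong HW (*-identityʳ b)
HW-concat zero    {suc a} b (s≤s ())
HW-concat (suc k) {a}     b a< with binary a
... | d +[ a′ ]*2 = begin
  HW (toℕ d + a′ * 2 + b * (2 * 2 ^ k))  ≡⟨ cong HW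
    (solve 4 (λ d a b p → d :+ a :* con 2 :+ b :* (con 2 :* p) := d :+ (a :+ b :* p) :* con 2)
       refl (toℕ d) a′ b (2 ^ k)) ⟩
  HW (toℕ d + (a′ + b * 2 ^ k) * 2)      ≡⟨ HW-digit d (a′ + b * 2 ^ k) ⟩
  toℕ d + HW (a′ + b * 2 ^ k)            ≡⟨ cong (toℕ d +_) (HW-concat k b a′<) ⟩
  toℕ d + (HW a′ + HW b)                 ≡⟨ +-assoc (toℕ d) _ _ ⟨
  toℕ d + HW a′ + HW b                   ≡⟨ cong (_+ HW b) (HW-digit d a′) ⟨
  HW (toℕ d + a′ * 2) + HW b             ∎
  where
  open ≡-Reasoning
  a′< : a′ < 2 ^ k
  a′< = *-cancelʳ-< 2 a′ (2 ^ k)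
    (≤-<-trans (m≤n+m (a′ * 2) (toℕ d)) (subst (toℕ d + a′ * 2 <_) (*-comm 2 (2 ^ k)) a<))

-- The hypothesis makes `b` the `k`-bit complement of `a`, so in each position exactly one of the
-- two has a one.
HW-complement : ∀ k a b → suc (a + b) ≡ 2 ^ k → HW a + HW b ≡ k
HW-complement zero    zero zero eq = refl
HW-complement (suc k) a    b    eq with binary a | binary b
-- Equal lowest bits would make `suc (a + b)` odd, but it is `2 * 2 ^ k`.
... | zero +[ a′ ]*2 | zero +[ b′ ]*2 = contradiction
  (sym (trans (cong suc (solve 2 (λ a b → con 2 :* (a :+ b) := a :* con 2 :+ b :* con 2) refl a′ b′)) eq))
  (even≢odd (2 ^ k) (a′ + b′))
... | suc zero +[ a′ ]*2 | suc zero +[ b′ ]*2 = contradiction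
  (sym (trans (cong suc (solve 2 (λ a b → con 2 :* (con 1 :+ a :+ b)
    := con 1 :+ a :* con 2 :+ (con 1 :+ b :* con 2)) refl a′ b′)) eq))
  (even≢odd (2 ^ k) (1 + a′ + b′))
... | zero +[ a′ ]*2 | suc zero +[ b′ ]*2 = begin
  HW (a′ * 2) + HW (1 + b′ * 2)  ≡⟨ cong₂ _+_ (HW-digit zero a′) (HW-digit 1b b′) ⟩
  HW a′ + suc (HW b′)            ≡⟨ +-suc (HW a′) (HW b′) ⟩
  suc (HW a′ + HW b′)            ≡⟨ cong suc (HW-complement k a′ b′ (*-cancelˡ-≡ _ _ 2 (trans
    (solve 2 (λ a b → con 2 :* (con 1 :+ (a :+ b)) := con 1 :+ (a :* con 2 :+ (con 1 :+ b :* con 2))) refl a′ b′)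
    eq))) ⟩
  suc k                          ∎
  where open ≡-Reasoning
... | suc zero +[ a′ ]*2 | zero +[ b′ ]*2 = begin
  HW (1 + a′ * 2) + HW (b′ * 2)  ≡⟨ cong₂ _+_ (HW-digit 1b a′) (HW-digit zero b′) ⟩
  suc (HW a′ + HW b′)            ≡⟨ cong suc (HW-complement k a′ b′ (*-cancelˡ-≡ _ _ 2 (trans
    (solve 2 (λ a b → con 2 :* (con 1 :+ (a :+ b)) := con 1 :+ (con 1 :+ a :* con 2 :+ b :* con 2)) refl a′ b′)
    eq))) ⟩
  suc k                          ∎
  where open ≡-Reasoning

-- Indicators and sums

𝟙 : ∀ {P : Set} → Dec P → ℕ
𝟙 P? = if does P? then 1 else 0

∑-const : ∀ t k → ∑[ i < t ] k ≡ t * k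
∑-const zero    k = refl
∑-const (suc t) k = cong (k +_) (∑-const t k)

∑-𝟙-∄ : ∀ {t} {P : Fin t → Set} (P? : Decidable P) → (∀ i → ¬ P i) → ∑[ i < t ] 𝟙 (P? i) ≡ 0
∑-𝟙-∄ {zero}  P? ¬P = refl
∑-𝟙-∄ {suc t} P? ¬P with P? zero
... | yes p = contradiction p (¬P zero)
... | no  _ = ∑-𝟙-∄ (P? ∘ suc) (¬P ∘ suc)

-- The sum counts the witnesses of `P`: there is at most one, and there is one exactly when `Q`
-- holds.
∑-𝟙-! : ∀ {t} {P : Fin t → Set} {Q : Set} (P? : Decidable P) (Q? : Dec Q) →
        (∀ i → P i → Q) → (Q → ∃ P) → (∀ i j → P i → P j → i ≡ j) →
        ∑[ i < t ] 𝟙 (P? i) ≡ 𝟙 Q?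
∑-𝟙-! P? (no ¬q) sound complete unique = ∑-𝟙-∄ P? (λ i p → ¬q (sound i p))
∑-𝟙-! P? (yes q) sound complete unique = go P? (complete q) unique
  where
  -- Quantifying anew over `t` and `P` lets the induction pass to the shifted predicate `P ∘ suc`.
  go : ∀ {t} {P : Fin t → Set} (P? : Decidable P) → ∃ P → (∀ i j → P i → P j → i ≡ j) →
       ∑[ i < t ] 𝟙 (P? i) ≡ 1
  go {suc t} P? (i , pᵢ) unique with P? zero
  ... | yes p₀ = cong suc (∑-𝟙-∄ (P? ∘ suc) λ j p → contradiction (unique zero (suc j) p₀ p) λ ())
  go {suc t} P? (zero  , p) unique | no ¬p₀ = contradiction p ¬p₀
  go {suc t} P? (suc i , p) unique | no ¬p₀ =
    go (P? ∘ suc) (i , p) λ j k pⱼ pₖ → Fin.suc-injective (unique (suc j) (suc k) pⱼ pₖ)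

length-filter-tabulate : ∀ {a} {A : Set a} {P : A → Set} (P? : Decidable P) {n} (f : Fin n → A) →
                         length (filter P? (tabulate f)) ≡ ∑[ i < n ] 𝟙 (P? (f i))
length-filter-tabulate P? {zero}  f = refl
length-filter-tabulate P? {suc n} f with P? (f zero)
... | yes _ = cong suc (length-filter-tabulate P? (f ∘ suc))
... | no  _ = length-filter-tabulate P? (f ∘ suc)

length-filter-cartesianProduct :
  ∀ {a b} {A : Set a} {B : Set b} {P : A × B → Set} (P? : Decidable P)
  {m n} (f : Fin m → A) (g : Fin n → B) →
  length (filter P? (cartesianProduct (tabulate f) (tabulate g)))
    ≡ ∑[ i < m ] ∑[ j < n ] 𝟙 (P? (f i , g j))
length-filter-cartesianProduct P? {zero}      f g = refl
length-filter-cartesianProduct P? {suc m} {n} f g = begin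
  length (filter P? (row ++ rest))                   ≡⟨ cong length (filter-++ P? row rest) ⟩
  length (filter P? row ++ filter P? rest)           ≡⟨ length-++ (filter P? row) ⟩
  length (filter P? row) + length (filter P? rest)   ≡⟨ cong₂ _+_
    (trans (cong (length ∘ filter P?) (map-tabulate g (f zero ,_)))
           (length-filter-tabulate P? ((f zero ,_) ∘ g)))
    (length-filter-cartesianProduct P? (f ∘ suc) g) ⟩
  ∑[ j < n ] 𝟙 (P? (f zero , g j)) + ∑[ i < m ] ∑[ j < n ] 𝟙 (P? (f (suc i) , g j)) ∎
  where
  open ≡-Reasoning
  row  = map (f zero ,_) (tabulate g)
  rest = cartesianProduct (tabulate (f ∘ suc)) (tabulate g)

-- Positional notation

-- The digits may exceed `Q`, which makes the expansion linear in `f`. Bounds on the digits enter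
-- only in `radix-<` and `HW-radix`.
radix : ℕ → (t : ℕ) → (Fin t → ℕ) → ℕ
radix Q t f = ∑[ i < t ] (f i * Q ^ toℕ i)

radix-cong : ∀ Q {t} {f g : Fin t → ℕ} → f ≗ g → radix Q t f ≡ radix Q t g
radix-cong Q f≗g = sum-cong-≗ λ i → cong (_* Q ^ toℕ i) (f≗g i)

radix-+ : ∀ Q {t} (f g : Fin t → ℕ) → radix Q t (λ i → f i + g i) ≡ radix Q t f + radix Q t g
radix-+ Q f g = trans
  (sum-cong-≗ λ i → *-distribʳ-+ (Q ^ toℕ i) (f i) (g i))
  (∑-distrib-+ (λ i → f i * Q ^ toℕ i) (λ i → g i * Q ^ toℕ i))

radix-*ˡ : ∀ Q {t} a (f : Fin t → ℕ) → radix Q t (λ i → a * f i) ≡ a * radix Q t f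
radix-*ˡ Q a f = trans
  (sum-cong-≗ λ i → *-assoc a (f i) (Q ^ toℕ i))
  (sym (*-distribˡ-sum a (λ i → f i * Q ^ toℕ i)))

radix-*ʳ : ∀ Q {t} a (f : Fin t → ℕ) → radix Q t (λ i → f i * a) ≡ radix Q t f * a
radix-*ʳ Q a f = trans
  (radix-cong Q λ i → *-comm (f i) a)
  (trans (radix-*ˡ Q a f) (*-comm a _))

-- Horner's form: lowest digit plus a shifted remainder, as `HW-concat` expects.
radix-suc : ∀ Q {t} (f : Fin (suc t) → ℕ) → radix Q (suc t) f ≡ f zero + radix Q t (f ∘ suc) * Q
radix-suc Q f = cong₂ _+_ (*-identityʳ (f zero)) (trans
  (sum-cong-≗ λ i → solve 3 (λ a b c → a :* (b :* c) := a :* c :* b) refl (f (suc i)) Q (Q ^ toℕ i))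
  (sym (*-distribʳ-sum Q (λ i → f (suc i) * Q ^ toℕ i))))

radix-< : ∀ Q t (f : Fin t → ℕ) → (∀ i → f i < Q) → radix Q t f < Q ^ t
radix-< Q zero    f f< = z<s
radix-< Q (suc t) f f< = begin-strict
  radix Q (suc t) f                   ≡⟨ radix-suc Q f ⟩
  f zero + radix Q t (f ∘ suc) * Q    <⟨ +-monoˡ-< _ (f< zero) ⟩
  suc (radix Q t (f ∘ suc)) * Q       ≤⟨ *-monoˡ-≤ Q (radix-< Q t (f ∘ suc) (f< ∘ suc)) ⟩
  Q ^ t * Q                           ≡⟨ *-comm (Q ^ t) Q ⟩
  Q ^ suc t                           ∎
  where open ≤-Reasoning

-- The base is a variable with an equation because `q ^ n` and `q ^ (n ^ 2)` are powers of two only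
-- up to a proof.
HW-radix : ∀ k Q t (f : Fin t → ℕ) → Q ≡ 2 ^ k → (∀ i → f i < Q) →
           HW (radix Q t f) ≡ ∑[ i < t ] HW (f i)
HW-radix k Q       zero    f eq   f< = refl
HW-radix k .(2 ^ k) (suc t) f refl f< = begin
  HW (radix Q (suc t) f)                  ≡⟨ cong HW (radix-suc Q f) ⟩
  HW (f zero + radix Q t (f ∘ suc) * Q)   ≡⟨ HW-concat k (radix Q t (f ∘ suc)) (f< zero) ⟩
  HW (f zero) + HW (radix Q t (f ∘ suc))  ≡⟨ cong (HW (f zero) +_) (HW-radix k Q t (f ∘ suc) refl (f< ∘ suc)) ⟩
  HW (f zero) + ∑[ i < t ] HW (f (suc i)) ∎
  where
  open ≡-Reasoning
  Q = 2 ^ k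

sum-applyUpTo : ∀ f t → List.sum (applyUpTo f t) ≡ ∑[ i < t ] f (toℕ i)
sum-applyUpTo f zero    = refl
sum-applyUpTo f (suc t) = cong (f 0 +_) (sum-applyUpTo (f ∘ suc) t)

-- The upper limit of `G` is inclusive while `radix` counts terms; the equation bridges this for
-- `n ∸ 1` and `T ∸ 1`.
G-radix : ∀ r q {s t} → suc s ≡ t → G r q s ≡ radix q t (λ i → toℕ i ^ r)
G-radix r q {s} refl = trans
  (cong List.sum (map-applyUpTo id (λ j → j ^ r * q ^ j) (suc s)))
  (sum-applyUpTo (λ j → j ^ r * q ^ j) (suc s))

-- Binary weight and size of a single block

suc[2^w∸1] : ∀ w → suc (2 ^ w ∸ 1) ≡ 2 ^ w
suc[2^w∸1] w = m+[n∸m]≡n (m^n>0 2 w)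

-- For c = 2ʷ + 1 the product is all ones; for c = k + 1 ≤ 2ʷ it is k · 2ʷ plus the w-bit complement of k.
HW-block : ∀ w {c e} → c + e ≡ 2 ^ w + 1 → e ≤ 2 ^ w →
           HW ((2 ^ w ∸ 1) * c) ≡ (1 + 𝟙 (e ℕ.≟ 0)) * w
HW-block w {c} {zero} c+e≡ e≤ = begin
  HW ((2 ^ w ∸ 1) * c)            ≡⟨ cong HW split ⟩
  HW (p + p * 2 ^ w)              ≡⟨ HW-concat w p p< ⟩
  HW p + HW p                     ≡⟨ cong₂ _+_ HW-p HW-p ⟩
  w + w                           ≡⟨ cong (w +_) (+-identityʳ w) ⟨
  2 * w                           ∎
  where
  open ≡-Reasoning
  p = 2 ^ w ∸ 1
  p< : p < 2 ^ w
  p< = ≤-reflexive (suc[2^w∸1] w)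
  HW-p : HW p ≡ w
  HW-p = trans (sym (+-identityʳ (HW p))) (HW-complement w p 0 (trans (cong suc (+-identityʳ p)) (suc[2^w∸1] w)))
  split : p * c ≡ p + p * 2 ^ w
  split = trans (cong (p *_) (trans (sym (+-identityʳ c)) c+e≡))
    (solve 2 (λ p x → p :* (x :+ con 1) := p :+ p :* x) refl p (2 ^ w))
-- `c = 0` would force `e = 2ʷ + 1`, beyond the bound on `e`.
HW-block w {zero}  {suc l} c+e≡ e≤ =
  contradiction (subst (_≤ 2 ^ w) (trans c+e≡ (+-comm (2 ^ w) 1)) e≤) (<-irrefl refl)
HW-block w {suc k} {suc l} c+e≡ e≤ = begin
  HW ((2 ^ w ∸ 1) * suc k)        ≡⟨ cong (λ x → HW ((x ∸ 1) * suc k)) (sym l+k) ⟩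
  HW ((l + k) * suc k)            ≡⟨ cong HW (trans
    (solve 2 (λ l k → (l :+ k) :* (con 1 :+ k) := l :+ k :* (con 1 :+ (l :+ k))) refl l k)
    (cong (λ x → l + k * x) l+k)) ⟩
  HW (l + k * 2 ^ w)              ≡⟨ HW-concat w k (≤-trans (s≤s (m≤m+n l k)) (≤-reflexive l+k)) ⟩
  HW l + HW k                     ≡⟨ HW-complement w l k l+k ⟩
  w                               ≡⟨ *-identityˡ w ⟨
  1 * w                           ∎
  where
  open ≡-Reasoning
  l+k : suc (l + k) ≡ 2 ^ w
  l+k = suc-injective (trans
    (solve 2 (λ l k → con 1 :+ (con 1 :+ (l :+ k)) := con 1 :+ k :+ (con 1 :+ l)) refl l k)
    (trans c+e≡ (+-comm (2 ^ w) 1)))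

-- Since `c ≤ 2ʷ + 1`, the product is at most (2ʷ - 1)(2ʷ + 1) = 2²ʷ - 1.
block-< : ∀ w {c e} → c + e ≡ 2 ^ w + 1 → (2 ^ w ∸ 1) * c < 2 ^ (2 * w)
block-< w {c} {e} c+e≡ = begin-strict
  (2 ^ w ∸ 1) * c             ≤⟨ *-monoʳ-≤ p (m≤m+n c e) ⟩
  (2 ^ w ∸ 1) * (c + e)       ≡⟨ cong (p *_) (trans c+e≡ (cong (_+ 1) (sym (suc[2^w∸1] w)))) ⟩
  p * (suc p + 1)             <⟨ ≤-refl ⟩
  suc (p * (suc p + 1))       ≡⟨ solve 1 (λ p → con 1 :+ p :* (con 1 :+ p :+ con 1)
                                          := (con 1 :+ p) :* (con 1 :+ p)) refl p ⟩
  suc p * suc p               ≡⟨ cong₂ _*_ (suc[2^w∸1] w) (suc[2^w∸1] w) ⟩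
  2 ^ w * 2 ^ w               ≡⟨ ^-distribˡ-+-* 2 w w ⟨
  2 ^ (w + w)                 ≡⟨ cong (λ x → 2 ^ (w + x)) (+-identityʳ w) ⟨
  2 ^ (2 * w)                 ∎
  where
  open ≤-Reasoning
  p = 2 ^ w ∸ 1

-- Arithmetic bounds

cubic-≤ : ∀ {n x a b} → x < n → a < n → b < n → x ^ 3 + a * x + b ≤ n ^ 3
cubic-≤ {suc p} {x} {a} {b} (s≤s x≤p) (s≤s a≤p) (s≤s b≤p) = begin
  x ^ 3 + a * x + b                         ≤⟨ +-mono-≤ (+-mono-≤ (^-monoˡ-≤ 3 x≤p) (*-mono-≤ a≤p x≤p)) b≤p ⟩
  p ^ 3 + p * p + p                         ≤⟨ m≤m+n _ _ ⟩
  p ^ 3 + p * p + p + (2 * p ^ 2 + 2 * p + 1) ≡⟨ solve 1 (λ p → p :^ 3 :+ p :* p :+ p :+ (con 2 :* p :^ 2 :+ con 2 :* p :+ con 1)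
                                                  := (con 1 :+ p) :^ 3) refl p ⟩
  suc p ^ 3                                 ∎
  where open ≤-Reasoning

-- With h(n) = n³ + n², the ratio h(n+1)/h(n) is at most 7/5 from n = 9 on, and (7/5)² = 49/25 < 2,
-- so doubling the right side outpaces the left. The cases up to 9 are evaluated.
growth : ∀ n → (n ^ 3 + n ^ 2) ^ 2 ≤ 2 ^ (n + 12)
growth n with ≤-total 9 n
... | inj₁ 9≤n = large (≤⇒≤′ 9≤n)
  where
  step : ∀ n → 9 ≤ n → 5 * (suc n ^ 3 + suc n ^ 2) ≤ 7 * (n ^ 3 + n ^ 2)
  step n 9≤n with k , refl ← m≤n⇒∃[o]m+o≡n 9≤n = begin
    5 * ((10 + k) ^ 3 + (10 + k) ^ 2)  ≤⟨ m≤m+n _ _ ⟩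
    -- The added term is 7h(n) - 5h(n+1) = (n+1)(2n² - 15n - 10) at n = 9 + k, where all its
    -- coefficients are nonnegative.
    5 * ((10 + k) ^ 3 + (10 + k) ^ 2) + (10 + k) * (17 + 21 * k + 2 * k ^ 2)
      ≡⟨ solve 1 (λ k → con 5 :* ((con 10 :+ k) :^ 3 :+ (con 10 :+ k) :^ 2)
             :+ (con 10 :+ k) :* (con 17 :+ con 21 :* k :+ con 2 :* k :^ 2)
           := con 7 :* ((con 9 :+ k) :^ 3 :+ (con 9 :+ k) :^ 2)) refl k ⟩
    7 * ((9 + k) ^ 3 + (9 + k) ^ 2)    ∎
    where open ≤-Reasoning
  large : ∀ {n} → 9 ≤′ n → (n ^ 3 + n ^ 2) ^ 2 ≤ 2 ^ (n + 12)
  large ≤′-refl = ≤ᵇ⇒≤ _ _ _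
  large (≤′-step {n} 9≤′n) = *-cancelˡ-≤ 25 (begin
    25 * h′ ^ 2               ≡⟨ solve 1 (λ x → con 25 :* x :^ 2 := (con 5 :* x) :^ 2) refl h′ ⟩
    (5 * h′) ^ 2              ≤⟨ ^-monoˡ-≤ 2 (step n (≤′⇒≤ 9≤′n)) ⟩
    (7 * h) ^ 2               ≡⟨ solve 1 (λ x → (con 7 :* x) :^ 2 := con 49 :* x :^ 2) refl h ⟩
    49 * h ^ 2                ≤⟨ *-mono-≤ (≤ᵇ⇒≤ 49 50 _) (large 9≤′n) ⟩
    50 * 2 ^ (n + 12)         ≡⟨ solve 1 (λ x → con 50 :* x := con 25 :* (con 2 :* x)) refl (2 ^ (n + 12)) ⟩
    25 * 2 ^ (suc n + 12)     ∎)
    where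
    open ≤-Reasoning
    h  = n ^ 3 + n ^ 2
    h′ = suc n ^ 3 + suc n ^ 2
... | inj₂ n≤9 = small n≤9
  where
  small : ∀ {n} → n ≤ 9 → (n ^ 3 + n ^ 2) ^ 2 ≤ 2 ^ (n + 12)
  small {0} _ = ≤ᵇ⇒≤ _ _ _
  small {1} _ = ≤ᵇ⇒≤ _ _ _
  small {2} _ = ≤ᵇ⇒≤ _ _ _
  small {3} _ = ≤ᵇ⇒≤ _ _ _
  small {4} _ = ≤ᵇ⇒≤ _ _ _
  small {5} _ = ≤ᵇ⇒≤ _ _ _
  small {6} _ = ≤ᵇ⇒≤ _ _ _
  small {7} _ = ≤ᵇ⇒≤ _ _ _
  small {8} _ = ≤ᵇ⇒≤ _ _ _
  small {9} _ = ≤ᵇ⇒≤ _ _ _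
  small {suc (suc (suc (suc (suc (suc (suc (suc (suc (suc _)))))))))}
    (s≤s (s≤s (s≤s (s≤s (s≤s (s≤s (s≤s (s≤s (s≤s ())))))))))

∣m-n∣≤ : ∀ {m n k} → m ≤ n + k → n ≤ m + k → ∣ m - n ∣ ≤ k
∣m-n∣≤ {m} {n} {k} m≤ n≤ with ≤-total m n
... | inj₁ m≤n = subst (_≤ k) (sym (m≤n⇒∣m-n∣≡n∸m m≤n)) (m≤n+o⇒m∸n≤o n m n≤)
... | inj₂ n≤m = subst (_≤ k) (sym (m≤n⇒∣n-m∣≡n∸m n≤m)) (m≤n+o⇒m∸n≤o m n m≤)

-- The square of a difference without negative terms: `S⁺` carries the two squares, `S⁻` the cross
-- term.
m²+n²≡2mn+∣m-n∣² : ∀ m n → m ^ 2 + n ^ 2 ≡ 2 * (m * n) + ∣ m - n ∣ ^ 2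
m²+n²≡2mn+∣m-n∣² m n with ≤-total m n
... | inj₁ m≤n with d , refl ← m≤n⇒∃[o]m+o≡n m≤n = trans
  (solve 2 (λ m d → m :^ 2 :+ (m :+ d) :^ 2 := con 2 :* (m :* (m :+ d)) :+ d :^ 2) refl m d)
  (cong (λ x → 2 * (m * (m + d)) + x ^ 2) (sym (∣m-m+n∣≡n m d)))
... | inj₂ n≤m with d , refl ← m≤n⇒∃[o]m+o≡n n≤m = trans
  (solve 2 (λ n d → (n :+ d) :^ 2 :+ n :^ 2 := con 2 :* ((n :+ d) :* n) :+ d :^ 2) refl n d)
  (cong (λ x → 2 * ((n + d) * n) + x ^ 2) (sym (trans (∣-∣-comm (n + d) n) (∣m-m+n∣≡n n d))))

-- Congruences

module _ {n : ℕ} .{{_ : NonZero n}} where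

  toℕ-mod : ∀ a → toℕ (a mod n) ≡ a % n
  toℕ-mod a = toℕ-fromℕ< (m%n<n a n)

  [m%n+o]%n : ∀ a b → (a % n + b) % n ≡ (a + b) % n
  [m%n+o]%n a b = trans (%-distribˡ-+ (a % n) b n)
    (trans (cong (λ x → (x + b % n) % n) (m%n%n≡m%n a n)) (sym (%-distribˡ-+ a b n)))

  [m%n*o]%n : ∀ a b → (a % n * b) % n ≡ (a * b) % n
  [m%n*o]%n a b = trans (%-distribˡ-* (a % n) b n)
    (trans (cong (λ x → (x * (b % n)) % n) (m%n%n≡m%n a n)) (sym (%-distribˡ-* a b n)))

  [m+o]%n≡m%n⇒n∣o : ∀ m o → (m + o) % n ≡ m % n → n ∣ o
  [m+o]%n≡m%n⇒n∣o m o eq = divides ((m + o) / n ∸ m / n) (begin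
    o                                                         ≡⟨ m+n∸m≡n m o ⟨
    (m + o) ∸ m                                               ≡⟨ cong₂ _∸_ (m≡m%n+[m/n]*n (m + o) n) (m≡m%n+[m/n]*n m n) ⟩
    (m + o) % n + (m + o) / n * n ∸ (m % n + m / n * n)       ≡⟨ cong (λ x → x + (m + o) / n * n ∸ (m % n + m / n * n)) eq ⟩
    m % n + (m + o) / n * n ∸ (m % n + m / n * n)             ≡⟨ [m+n]∸[m+o]≡n∸o (m % n) _ _ ⟩
    (m + o) / n * n ∸ m / n * n                               ≡⟨ *-distribʳ-∸ n ((m + o) / n) (m / n) ⟨
    ((m + o) / n ∸ m / n) * n                                 ∎)
    where open ≡-Reasoning

-- The residual and its bounds

module Reduction (n A B : ℕ) .{{_ : NonZero n}} where

  open IntegersMod n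
  open Curve n A B

  -- This is E of the introduction. The bars and the minus form the single operator `∣_-_∣`, so
  -- everything right of the minus, including `Ā * x + n * z`, is subtracted.
  residual : (x y z : ℕ) → ℕ
  residual x y z = ∣ y ^ 2 + m - x ^ 3 + Ā * x + n * z ∣ ^ 2

  coefficient : (x y z : ℕ) → ℕ
  coefficient x y z = 2 ^ w + 1 ∸ residual x y z

  gap : (x y : ℕ) → ℕ
  gap x y = y ^ 2 + m ∸ (x ^ 3 + Ā * x)

  m+B̄ : m + B̄ ≡ n ^ 3
  m+B̄ = m∸n+n≡m (≤-trans (<⇒≤ (m%n<n B n)) n≤n³)
    where
    n≤n³ : n ≤ n ^ 3
    n≤n³ = subst (_≤ n ^ 3) (^-identityʳ n) (^-monoʳ-≤ n {1} {3} (s≤s z≤n))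

  -- `m` is congruent to -B modulo `n` and yet large enough to absorb the cubic, so the subtraction
  -- in `gap` is never truncated.
  cubic≤m : ∀ {x} → x < n → x ^ 3 + Ā * x ≤ m
  cubic≤m {x} x<n = m+n≤o⇒m≤o∸n (x ^ 3 + Ā * x) (cubic-≤ x<n (m%n<n A n) (m%n<n B n))

  cubic+gap : ∀ {x} y → x < n → x ^ 3 + Ā * x + gap x y ≡ y ^ 2 + m
  cubic+gap y x<n = m+[n∸m]≡n (≤-trans (cubic≤m x<n) (m≤n+m m (y ^ 2)))

  T≡suc : T ≡ suc (n ^ 2 + n)
  T≡suc = +-comm (n ^ 2 + n) 1

  nT≡ : n * T ≡ n ^ 2 + n ^ 3 + n
  nT≡ = solve 1 (λ n → n :* (n :^ 2 :+ n :+ con 1) := n :^ 2 :+ n :^ 3 :+ n) refl n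

  -- This makes `T` large enough: if `n` divides the gap, the quotient is a legitimate `z`.
  gap<nT : ∀ x {y} → y < n → gap x y < n * T
  gap<nT x {y} y<n = begin-strict
    gap x y              ≤⟨ m∸n≤m _ (x ^ 3 + Ā * x) ⟩
    y ^ 2 + m            <⟨ +-mono-<-≤ (^-monoˡ-< 2 y<n) (m∸n≤m (n ^ 3) B̄) ⟩
    n ^ 2 + n ^ 3        ≤⟨ m≤m+n _ n ⟩
    n ^ 2 + n ^ 3 + n    ≡⟨ nT≡ ⟨
    n * T                ∎
    where open ≤-Reasoning

  -- The left argument of the distance is at most n² + n³. The right one exceeds the left by at most
  -- `n * z`, since `m` absorbs the cubic, and `z ≤ n ^ 2 + n` bounds this by n³ + n² too.
  residual≤ : ∀ {x y z} → x < n → y < n → z < T → residual x y z ≤ 2 ^ w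
  residual≤ {x} {y} {z} x<n y<n z<T = ≤-trans (^-monoˡ-≤ 2 (∣m-n∣≤ above below)) (growth n)
    where
    open ≤-Reasoning
    above : y ^ 2 + m ≤ x ^ 3 + Ā * x + n * z + (n ^ 3 + n ^ 2)
    above = begin
      y ^ 2 + m          ≤⟨ +-mono-≤ (^-monoˡ-≤ 2 (<⇒≤ y<n)) (m∸n≤m (n ^ 3) B̄) ⟩
      n ^ 2 + n ^ 3      ≡⟨ +-comm (n ^ 2) (n ^ 3) ⟩
      n ^ 3 + n ^ 2      ≤⟨ m≤n+m (n ^ 3 + n ^ 2) (x ^ 3 + Ā * x + n * z) ⟩
      _                  ∎
    below : x ^ 3 + Ā * x + n * z ≤ y ^ 2 + m + (n ^ 3 + n ^ 2)
    below = begin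
      x ^ 3 + Ā * x + n * z      ≤⟨ +-mono-≤ (cubic≤m x<n) (*-monoʳ-≤ n (≤-pred (subst (z <_) T≡suc z<T))) ⟩
      m + n * (n ^ 2 + n)        ≤⟨ +-monoˡ-≤ _ (m≤n+m m (y ^ 2)) ⟩
      y ^ 2 + m + n * (n ^ 2 + n) ≡⟨ cong (y ^ 2 + m +_)
        (solve 1 (λ n → n :* (n :^ 2 :+ n) := n :^ 3 :+ n :^ 2) refl n) ⟩
      y ^ 2 + m + (n ^ 3 + n ^ 2) ∎

  coefficient+residual : ∀ {x y z} → x < n → y < n → z < T → coefficient x y z + residual x y z ≡ 2 ^ w + 1
  coefficient+residual x<n y<n z<T = m∸n+n≡m (≤-trans (residual≤ x<n y<n z<T) (m≤m+n (2 ^ w) 1))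

  -- Points on the curve

  [x³+Ax+B]%n : ∀ x → toℕ (x ⊗ x ⊗ x ⊕ ⟦ A ⟧ ⊗ x ⊕ ⟦ B ⟧) ≡ (toℕ x ^ 3 + Ā * toℕ x + B̄) % n
  [x³+Ax+B]%n x = begin
    toℕ (x ⊗ x ⊗ x ⊕ ⟦ A ⟧ ⊗ x ⊕ ⟦ B ⟧)                       ≡⟨ toℕ-mod _ ⟩
    (toℕ (x ⊗ x ⊗ x ⊕ ⟦ A ⟧ ⊗ x) + toℕ ⟦ B ⟧) % n            ≡⟨ cong₂ (λ a b → (a + b) % n) (toℕ-mod _) (toℕ-mod B) ⟩
    ((toℕ (x ⊗ x ⊗ x) + toℕ (⟦ A ⟧ ⊗ x)) % n + B̄) % n        ≡⟨ [m%n+o]%n _ B̄ ⟩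
    (toℕ (x ⊗ x ⊗ x) + toℕ (⟦ A ⟧ ⊗ x) + B̄) % n              ≡⟨ cong₂ (λ a b → (a + b + B̄) % n) x³ Ax ⟩
    (u ^ 3 % n + (Ā * u) % n + B̄) % n                         ≡⟨ [m%n+o]%n (u ^ 3 % n + (Ā * u) % n) B̄ ⟨
    ((u ^ 3 % n + (Ā * u) % n) % n + B̄) % n                   ≡⟨ cong (λ a → (a + B̄) % n) (%-distribˡ-+ (u ^ 3) (Ā * u) n) ⟨
    ((u ^ 3 + Ā * u) % n + B̄) % n                             ≡⟨ [m%n+o]%n (u ^ 3 + Ā * u) B̄ ⟩
    (u ^ 3 + Ā * u + B̄) % n                                   ∎
    where
    open ≡-Reasoning
    u = toℕ x
    x³ : toℕ (x ⊗ x ⊗ x) ≡ u ^ 3 % n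
    x³ = begin
      toℕ (x ⊗ x ⊗ x)             ≡⟨ toℕ-mod _ ⟩
      (toℕ (x ⊗ x) * u) % n       ≡⟨ cong (λ a → (a * u) % n) (toℕ-mod (u * u)) ⟩
      ((u * u) % n * u) % n       ≡⟨ [m%n*o]%n (u * u) u ⟩
      (u * u * u) % n             ≡⟨ cong (_% n) (solve 1 (λ u → u :* u :* u := u :^ 3) refl u) ⟩
      u ^ 3 % n                   ∎
    Ax : toℕ (⟦ A ⟧ ⊗ x) ≡ (Ā * u) % n
    Ax = trans (toℕ-mod _) (cong (λ a → (a * u) % n) (toℕ-mod A))

  y²%n : ∀ y → toℕ (y ⊗ y) ≡ toℕ y ^ 2 % n
  y²%n y = trans (toℕ-mod _) (cong (λ a → (toℕ y * a) % n) (sym (*-identityʳ (toℕ y))))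

  module _ (x y : Fin n) where

    private
      u v d : ℕ
      u = toℕ x
      v = toℕ y
      d = gap u v

    -- Adding `B̄` completes `m` to n³, a multiple of `n`; modulo `n` the gap is therefore y² minus
    -- the right side of the curve equation.
    rhs+gap : u ^ 3 + Ā * u + B̄ + d ≡ v ^ 2 + n ^ 2 * n
    rhs+gap = begin
      u ^ 3 + Ā * u + B̄ + d     ≡⟨ solve 3 (λ r b d → r :+ b :+ d := r :+ d :+ b) refl (u ^ 3 + Ā * u) B̄ d ⟩
      u ^ 3 + Ā * u + d + B̄     ≡⟨ cong (_+ B̄) (cubic+gap v (toℕ<n x)) ⟩
      v ^ 2 + m + B̄             ≡⟨ +-assoc (v ^ 2) m B̄ ⟩
      v ^ 2 + (m + B̄)           ≡⟨ cong (v ^ 2 +_) (trans m+B̄ (*-comm n (n ^ 2))) ⟩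
      v ^ 2 + n ^ 2 * n          ∎
      where open ≡-Reasoning

    OnCurve⇒n∣gap : OnCurve (x , y) → n ∣ d
    OnCurve⇒n∣gap on = [m+o]%n≡m%n⇒n∣o (u ^ 3 + Ā * u + B̄) d (begin
      (u ^ 3 + Ā * u + B̄ + d) % n   ≡⟨ cong (_% n) rhs+gap ⟩
      (v ^ 2 + n ^ 2 * n) % n        ≡⟨ [m+kn]%n≡m%n (v ^ 2) (n ^ 2) n ⟩
      v ^ 2 % n                      ≡⟨ y²%n y ⟨
      toℕ (y ⊗ y)                    ≡⟨ cong toℕ on ⟩
      _                              ≡⟨ [x³+Ax+B]%n x ⟩
      (u ^ 3 + Ā * u + B̄) % n       ∎)
      where open ≡-Reasoning

    n∣gap⇒OnCurve : n ∣ d → OnCurve (x , y)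
    n∣gap⇒OnCurve n∣d = toℕ-injective (begin
      toℕ (y ⊗ y)                    ≡⟨ y²%n y ⟩
      v ^ 2 % n                      ≡⟨ [m+kn]%n≡m%n (v ^ 2) (n ^ 2) n ⟨
      (v ^ 2 + n ^ 2 * n) % n        ≡⟨ cong (_% n) rhs+gap ⟨
      (u ^ 3 + Ā * u + B̄ + d) % n   ≡⟨ %-remove-+ʳ (u ^ 3 + Ā * u + B̄) n∣d ⟩
      (u ^ 3 + Ā * u + B̄) % n       ≡⟨ [x³+Ax+B]%n x ⟨
      _                              ∎)
      where open ≡-Reasoning

    residual≡0⇒gap≡ : ∀ z → residual u v z ≡ 0 → d ≡ n * z
    residual≡0⇒gap≡ z eq = +-cancelˡ-≡ (u ^ 3 + Ā * u) d (n * z)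
      (trans (cubic+gap v (toℕ<n x)) (∣m-n∣≡0⇒m≡n (m^n≡0⇒m≡0 _ 2 eq)))

    gap≡⇒residual≡0 : ∀ z → d ≡ n * z → residual u v z ≡ 0
    gap≡⇒residual≡0 z eq = cong (_^ 2) (m≡n⇒∣m-n∣≡0
      (trans (sym (cubic+gap v (toℕ<n x))) (cong (u ^ 3 + Ā * u +_) eq)))

    ∑-residual≡0 : ∑[ z < T ] 𝟙 (residual u v (toℕ z) ℕ.≟ 0) ≡ 𝟙 (onCurve? (x , y))
    ∑-residual≡0 = ∑-𝟙-! (λ z → residual u v (toℕ z) ℕ.≟ 0) (onCurve? (x , y)) sound complete unique
      where
      sound : ∀ z → residual u v (toℕ z) ≡ 0 → OnCurve (x , y)
      sound z eq = n∣gap⇒OnCurve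
        (divides (toℕ z) (trans (residual≡0⇒gap≡ (toℕ z) eq) (*-comm n (toℕ z))))
      complete : OnCurve (x , y) → ∃ λ z → residual u v (toℕ z) ≡ 0
      -- The witness is the quotient of the gap by `n`.
      complete on with divides k d≡kn ← OnCurve⇒n∣gap on =
        fromℕ< k<T , gap≡⇒residual≡0 _ (trans d≡nk (cong (n *_) (sym (toℕ-fromℕ< k<T))))
        where
        d≡nk : d ≡ n * k
        d≡nk = trans d≡kn (*-comm k n)
        k<T : k < T
        k<T = *-cancelˡ-< n k T (subst (_< n * T) d≡nk (gap<nT u (toℕ<n y)))
      unique : ∀ z z′ → residual u v (toℕ z) ≡ 0 → residual u v (toℕ z′) ≡ 0 → z ≡ z′
      unique z z′ eq eq′ = toℕ-injective (*-cancelˡ-≡ (toℕ z) (toℕ z′) n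
        (trans (sym (residual≡0⇒gap≡ (toℕ z) eq)) (residual≡0⇒gap≡ (toℕ z′) eq′)))

  -- Expansion of M in base q

  Coefficients : Set
  Coefficients = Fin n → Fin n → Fin T → ℕ

  -- Three nested expansions give `c x y z` the weight q^(x + ny + n²z). The levels mirror the three
  -- factors of `S` and let `HW-radix` act on one variable at a time.
  row : Coefficients → Fin T → Fin n → ℕ
  row c z y = radix q n λ x → c x y z

  plane : Coefficients → Fin T → ℕ
  plane c z = radix (q ^ n) n (row c z)

  value : Coefficients → ℕ
  value c = radix (q ^ (n ^ 2)) T (plane c)

  -- A record rather than a synonym, so that unification recovers c from the type.
  record _⇓_ (s : ℕ) (c : Coefficients) : Set where
    constructor evaluates
    field evaluate : s ≡ value c

  open _⇓_

  infix  4 _⇓_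
  infixl 6 _⊞_
  infixr 7 _⊡_

  ⇓-resp : ∀ {s} {c c′ : Coefficients} → (∀ x y z → c x y z ≡ c′ x y z) → s ⇓ c → s ⇓ c′
  ⇓-resp eq (evaluates p) = evaluates (trans p
    (radix-cong (q ^ (n ^ 2)) {T} λ z → radix-cong (q ^ n) {n} λ y → radix-cong q {n} λ x → eq x y z))

  -- Linearity of `value`. With `_⊡_` and `S⇓` it evaluates a combination of sums `S` by mirroring
  -- its syntax; `⇓-resp` then simplifies the resulting coefficients.
  _⊞_ : ∀ {s s′} {c c′ : Coefficients} → s ⇓ c → s′ ⇓ c′ → s + s′ ⇓ λ x y z → c x y z + c′ x y z
  _⊞_ {c = c} {c′} (evaluates p) (evaluates p′) = evaluates (trans (cong₂ _+_ p p′) (sym (trans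
    (radix-cong (q ^ (n ^ 2)) {T} λ z → trans
      (radix-cong (q ^ n) {n} λ y → radix-+ q (λ x → c x y z) (λ x → c′ x y z))
      (radix-+ (q ^ n) (λ y → row c z y) (λ y → row c′ z y)))
    (radix-+ (q ^ (n ^ 2)) (plane c) (plane c′)))))

  _⊡_ : ∀ a {s} {c : Coefficients} → s ⇓ c → a * s ⇓ λ x y z → a * c x y z
  _⊡_ a {c = c} (evaluates p) = evaluates (trans (cong (a *_) p) (sym (trans
    (radix-cong (q ^ (n ^ 2)) {T} λ z → trans
      (radix-cong (q ^ n) {n} λ y → radix-*ˡ q a (λ x → c x y z))
      (radix-*ˡ (q ^ n) a (row c z)))
    (radix-*ˡ (q ^ (n ^ 2)) a (plane c)))))

  monomial : (i j k : ℕ) → Coefficients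
  monomial i j k x y z = toℕ x ^ i * toℕ y ^ j * toℕ z ^ k

  -- A monomial separates the variables, so distributivity merges the product of three sums into one
  -- triple sum.
  S⇓ : ∀ i j k → S i j k ⇓ monomial i j k
  S⇓ i j k = evaluates (begin
    G i q (n ∸ 1) * G j (q ^ n) (n ∸ 1) * G k (q ^ (n ^ 2)) (T ∸ 1)
      ≡⟨ cong₂ _*_ (cong₂ _*_ (G-radix i q (suc-pred n)) (G-radix j (q ^ n) (suc-pred n)))
                   (G-radix k (q ^ (n ^ 2)) suc[T∸1]) ⟩
    X * Y * radix (q ^ (n ^ 2)) T (λ z → toℕ z ^ k)
      ≡⟨ radix-*ˡ (q ^ (n ^ 2)) {T} (X * Y) (λ z → toℕ z ^ k) ⟨
    (radix (q ^ (n ^ 2)) T λ z → X * Y * toℕ z ^ k)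
      ≡⟨ radix-cong (q ^ (n ^ 2)) {T} (λ z → cong (_* toℕ z ^ k) (radix-*ˡ (q ^ n) {n} X (λ y → toℕ y ^ j))) ⟨
    (radix (q ^ (n ^ 2)) T λ z → (radix (q ^ n) n λ y → X * toℕ y ^ j) * toℕ z ^ k)
      ≡⟨ radix-cong (q ^ (n ^ 2)) {T} (λ z → radix-*ʳ (q ^ n) {n} (toℕ z ^ k) (λ y → X * toℕ y ^ j)) ⟨
    (radix (q ^ (n ^ 2)) T λ z → radix (q ^ n) n λ y → X * toℕ y ^ j * toℕ z ^ k)
      ≡⟨ radix-cong (q ^ (n ^ 2)) {T} (λ z → radix-cong (q ^ n) {n} λ y → trans
           (radix-*ʳ q {n} (toℕ z ^ k) (λ x → toℕ x ^ i * toℕ y ^ j))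
           (cong (_* toℕ z ^ k) (radix-*ʳ q {n} (toℕ y ^ j) (λ x → toℕ x ^ i)))) ⟨
    value (monomial i j k) ∎)
    where
    open ≡-Reasoning
    X = radix q n (λ x → toℕ x ^ i)
    Y = radix (q ^ n) n (λ y → toℕ y ^ j)
    suc[T∸1] : suc (T ∸ 1) ≡ T
    suc[T∸1] = trans (cong (λ t → suc (t ∸ 1)) T≡suc) (sym T≡suc)

  -- For l = y² + m and r = x³ + Āx + nz the coefficients here are 2ʷ + 1 + 2lr and in `subtrahend`
  -- l² + r²; they differ by 2ʷ + 1 - (l - r)².
  minuend : (2 ^ w + 1) * S 0 0 0 + S⁻ ⇓ λ x y z →
            2 ^ w + 1 + 2 * ((toℕ y ^ 2 + m) * (toℕ x ^ 3 + Ā * toℕ x + n * toℕ z))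
  minuend = ⇓-resp
    -- The zero exponents keep the left side in the shape of the `monomial` coefficients.
    (λ x y z → solve 7 (λ W m a n x y z →
      (W :+ con 1) :* (x :^ 0 :* y :^ 0 :* z :^ 0)
        :+ (con 2 :* (x :^ 3 :* y :^ 2 :* z :^ 0) :+ con 2 :* a :* (x :^ 1 :* y :^ 2 :* z :^ 0)
            :+ con 2 :* n :* (x :^ 0 :* y :^ 2 :* z :^ 1) :+ con 2 :* m :* (x :^ 3 :* y :^ 0 :* z :^ 0)
            :+ con 2 :* a :* m :* (x :^ 1 :* y :^ 0 :* z :^ 0)
            :+ con 2 :* m :* n :* (x :^ 0 :* y :^ 0 :* z :^ 1))
      := W :+ con 1 :+ con 2 :* ((y :^ 2 :+ m) :* (x :^ 3 :+ a :* x :+ n :* z)))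
      refl (2 ^ w) m Ā n (toℕ x) (toℕ y) (toℕ z))
    ((2 ^ w + 1) ⊡ S⇓ 0 0 0
     ⊞ (2 ⊡ S⇓ 3 2 0 ⊞ (2 * Ā) ⊡ S⇓ 1 2 0 ⊞ (2 * n) ⊡ S⇓ 0 2 1
        ⊞ (2 * m) ⊡ S⇓ 3 0 0 ⊞ (2 * Ā * m) ⊡ S⇓ 1 0 0 ⊞ (2 * m * n) ⊡ S⇓ 0 0 1))

  subtrahend : S⁺ ⇓ λ x y z →
               (toℕ y ^ 2 + m) ^ 2 + (toℕ x ^ 3 + Ā * toℕ x + n * toℕ z) ^ 2
  subtrahend = ⇓-resp
    (λ x y z → solve 6 (λ m a n x y z →
      x :^ 0 :* y :^ 4 :* z :^ 0 :+ m :^ 2 :* (x :^ 0 :* y :^ 0 :* z :^ 0) :+ x :^ 6 :* y :^ 0 :* z :^ 0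
        :+ a :^ 2 :* (x :^ 2 :* y :^ 0 :* z :^ 0) :+ n :^ 2 :* (x :^ 0 :* y :^ 0 :* z :^ 2)
        :+ con 2 :* m :* (x :^ 0 :* y :^ 2 :* z :^ 0) :+ con 2 :* a :* (x :^ 4 :* y :^ 0 :* z :^ 0)
        :+ con 2 :* n :* (x :^ 3 :* y :^ 0 :* z :^ 1) :+ con 2 :* a :* n :* (x :^ 1 :* y :^ 0 :* z :^ 1)
      := (y :^ 2 :+ m) :^ 2 :+ (x :^ 3 :+ a :* x :+ n :* z) :^ 2)
      refl m Ā n (toℕ x) (toℕ y) (toℕ z))
    (S⇓ 0 4 0 ⊞ (m ^ 2) ⊡ S⇓ 0 0 0 ⊞ S⇓ 6 0 0 ⊞ (Ā ^ 2) ⊡ S⇓ 2 0 0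
     ⊞ (n ^ 2) ⊡ S⇓ 0 0 2 ⊞ (2 * m) ⊡ S⇓ 0 2 0 ⊞ (2 * Ā) ⊡ S⇓ 4 0 0
     ⊞ (2 * n) ⊡ S⇓ 3 0 1 ⊞ (2 * Ā * n) ⊡ S⇓ 1 0 1)

  block : Coefficients
  block x y z = (2 ^ w ∸ 1) * coefficient (toℕ x) (toℕ y) (toℕ z)

  -- Truncation is avoided by adding: coefficientwise, minuend = subtrahend + `c`, so by linearity
  -- the minuend equals `S⁺ + value c` and `∸` returns `value c` exactly.
  M⇓ : M ⇓ block
  M⇓ = (2 ^ w ∸ 1) ⊡ evaluates (trans (cong (_∸ S⁺) difference) (m+n∸m≡n S⁺ (value c)))
    where
    c : Coefficients
    c x y z = coefficient (toℕ x) (toℕ y) (toℕ z)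
    l r e : Coefficients
    l x y z = toℕ y ^ 2 + m
    r x y z = toℕ x ^ 3 + Ā * toℕ x + n * toℕ z
    e x y z = residual (toℕ x) (toℕ y) (toℕ z)
    pointwise : ∀ x y z → 2 ^ w + 1 + 2 * (l x y z * r x y z) ≡ l x y z ^ 2 + r x y z ^ 2 + c x y z
    pointwise x y z = begin
      2 ^ w + 1 + 2 * (l x y z * r x y z)
        ≡⟨ cong (_+ 2 * (l x y z * r x y z)) (coefficient+residual {toℕ x} (toℕ<n x) (toℕ<n y) (toℕ<n z)) ⟨
      c x y z + e x y z + 2 * (l x y z * r x y z)
        ≡⟨ solve 3 (λ c e p → c :+ e :+ p := p :+ e :+ c) refl (c x y z) (e x y z) (2 * (l x y z * r x y z)) ⟩
      2 * (l x y z * r x y z) + e x y z + c x y z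
        ≡⟨ cong (_+ c x y z) (m²+n²≡2mn+∣m-n∣² (l x y z) (r x y z)) ⟨
      l x y z ^ 2 + r x y z ^ 2 + c x y z ∎
      where open ≡-Reasoning
    difference : (2 ^ w + 1) * S 0 0 0 + S⁻ ≡ S⁺ + value c
    difference = trans (evaluate (⇓-resp pointwise minuend))
                       (sym (evaluate (subtrahend ⊞ evaluates {c = c} refl)))

  -- Counting the ones of `M`

  HW-value : (c : Coefficients) → (∀ x y z → c x y z < q) →
             HW (value c) ≡ ∑[ z < T ] ∑[ y < n ] ∑[ x < n ] HW (c x y z)
  HW-value c c<q = trans
    (HW-radix (2 * w * n ^ 2) (q ^ (n ^ 2)) T (plane c) (^-*-assoc 2 (2 * w) (n ^ 2)) plane<)
    (sum-cong-≗ λ z → trans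
      (HW-radix (2 * w * n) (q ^ n) n (row c z) (^-*-assoc 2 (2 * w) n) (row< z))
      (sum-cong-≗ λ y → HW-radix (2 * w) q n (λ x → c x y z) refl (λ x → c<q x y z)))
    where
    row< : ∀ z y → row c z y < q ^ n
    row< z y = radix-< q n (λ x → c x y z) (λ x → c<q x y z)
    plane< : ∀ z → plane c z < q ^ (n ^ 2)
    -- `radix-<` gives the bound `(q ^ n) ^ n`; the `*-identityʳ` is there because `n ^ 2` unfolds
    -- to `n * (n * 1)`.
    plane< z = subst (plane c z <_)
      (trans (^-*-assoc q n n) (cong (λ k → q ^ (n * k)) (sym (*-identityʳ n))))
      (radix-< (q ^ n) n (row c z) (row< z))

  δ : Fin n → Fin n → Fin T → ℕ
  δ x y z = 𝟙 (residual (toℕ x) (toℕ y) (toℕ z) ℕ.≟ 0)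

  N-∑ : ∑[ z < T ] ∑[ y < n ] ∑[ x < n ] δ x y z ≡ N
  N-∑ = begin
    -- The exchanges bring the sum over `z` innermost, where `∑-residual≡0` collapses it.
    ∑[ z < T ] ∑[ y < n ] ∑[ x < n ] δ x y z          ≡⟨ sum-cong-≗ (λ z → ∑-comm (λ y x → δ x y z)) ⟩
    ∑[ z < T ] ∑[ x < n ] ∑[ y < n ] δ x y z          ≡⟨ ∑-comm (λ z x → ∑[ y < n ] δ x y z) ⟩
    ∑[ x < n ] ∑[ z < T ] ∑[ y < n ] δ x y z          ≡⟨ sum-cong-≗ (λ x → ∑-comm (λ z y → δ x y z)) ⟩
    ∑[ x < n ] ∑[ y < n ] ∑[ z < T ] δ x y z          ≡⟨ sum-cong-≗ (λ x → sum-cong-≗ (∑-residual≡0 x)) ⟩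
    ∑[ x < n ] ∑[ y < n ] 𝟙 (onCurve? (x , y))        ≡⟨ length-filter-cartesianProduct onCurve? id id ⟨
    N                                                 ∎
    where
    open ≡-Reasoning

  HW-M : HW M ≡ (n ^ 2 * T + N) * w
  HW-M = begin
    HW M                                              ≡⟨ cong HW (evaluate M⇓) ⟩
    HW (value block)                                  ≡⟨ HW-value block (λ x y z → block-< w (c+e x y z)) ⟩
    ∑[ z < T ] ∑[ y < n ] ∑[ x < n ] HW (block x y z) ≡⟨ (sum-cong-≗ λ z → sum-cong-≗ λ y → sum-cong-≗ λ x →
      HW-block w (c+e x y z) (residual≤ (toℕ<n x) (toℕ<n y) (toℕ<n z))) ⟩
    ∑[ z < T ] ∑[ y < n ] ∑[ x < n ] ((1 + δ x y z) * w) ≡⟨ (sum-cong-≗ λ z → trans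
      (sum-cong-≗ λ y → sym (*-distribʳ-sum w (λ x → 1 + δ x y z)))
      (sym (*-distribʳ-sum w (λ y → ∑[ x < n ] (1 + δ x y z))))) ⟩
    ∑[ z < T ] ((∑[ y < n ] ∑[ x < n ] (1 + δ x y z)) * w) ≡⟨ *-distribʳ-sum w (λ z → ∑[ y < n ] ∑[ x < n ] (1 + δ x y z)) ⟨
    (∑[ z < T ] ∑[ y < n ] ∑[ x < n ] (1 + δ x y z)) * w ≡⟨ cong (_* w) (begin
      ∑[ z < T ] ∑[ y < n ] ∑[ x < n ] (1 + δ x y z)
        ≡⟨ (sum-cong-≗ λ z → trans
             (sum-cong-≗ λ y → ∑-distrib-+ {n} (λ _ → 1) (λ x → δ x y z))
             (∑-distrib-+ {n} (λ _ → ∑[ x < n ] 1) (λ y → ∑[ x < n ] δ x y z))) ⟩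
      ∑[ z < T ] (∑[ y < n ] ∑[ x < n ] 1 + ∑[ y < n ] ∑[ x < n ] δ x y z)
        ≡⟨ ∑-distrib-+ {T} (λ _ → ∑[ y < n ] ∑[ x < n ] 1) (λ z → ∑[ y < n ] ∑[ x < n ] δ x y z) ⟩
      ∑[ z < T ] ∑[ y < n ] ∑[ x < n ] 1 + ∑[ z < T ] ∑[ y < n ] ∑[ x < n ] δ x y z
        ≡⟨ cong₂ _+_ volume N-∑ ⟩
      n ^ 2 * T + N ∎) ⟩
    (n ^ 2 * T + N) * w                               ∎
    where
    open ≡-Reasoning
    c+e : ∀ x y z → _
    c+e x y z = coefficient+residual {toℕ x} {toℕ y} {toℕ z} (toℕ<n x) (toℕ<n y) (toℕ<n z)
    volume : ∑[ z < T ] ∑[ y < n ] ∑[ x < n ] 1 ≡ n ^ 2 * T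
    volume = begin
      ∑[ z < T ] ∑[ y < n ] ∑[ x < n ] 1   ≡⟨ ∑-const T _ ⟩
      T * ∑[ y < n ] ∑[ x < n ] 1          ≡⟨ cong (T *_) (∑-const n _) ⟩
      T * (n * ∑[ x < n ] 1)               ≡⟨ cong (λ k → T * (n * k)) (∑-const n 1) ⟩
      T * n ^ 2                            ≡⟨ *-comm T (n ^ 2) ⟩
      n ^ 2 * T                            ∎

-- The first component records that `HW M / w` is an exact quotient, not a rounded one.
theorem1 : (n A B : ℕ) .{{_ : NonZero n}} →
    let open Curve n A B in
    (w ∣ HW M) × (N ≡ HW M / w ∸ n ^ 2 * T)
theorem1 n A B = divides (n ^ 2 * T + N) HW-M , (begin
  N                                        ≡⟨ m+n∸m≡n (n ^ 2 * T) N ⟨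
  n ^ 2 * T + N ∸ n ^ 2 * T                ≡⟨ cong (_∸ n ^ 2 * T) (m*n/n≡m (n ^ 2 * T + N) w) ⟨
  (n ^ 2 * T + N) * w / w ∸ n ^ 2 * T      ≡⟨ cong (λ k → k / w ∸ n ^ 2 * T) HW-M ⟨
  HW M / w ∸ n ^ 2 * T                     ∎)
  where
  open Curve n A B
  open Reduction n A B
  open ≡-Reasoning
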